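{- Let $\mathcal F_2$ be the set of the following five graphs: the path $P_4$; $K_5\setminus S_2$ (the complete graph on 5 vertices with the two edges of a path $uvw$ removed); $K_6\setminus M_2$ (the complete graph on 6 vertices with two disjoint edges removed); the graph on vertices $1,\dots,5$ with edges $23,24,34,14,45$ (a triangle with two pendant vertices attached to the same triangle vertex); and the graph on vertices $1,\dots,5$ with edges $12,14,23,24,34,45$ (the diamond $K_4$ minus edge $13$ with a pendant vertex attached to the degree-3 vertex $4$). A simple connected graph $G$ is $\mathcal F_2$-free (no induced subgraph of $G$ is isomorphic to a member of $\mathcal F_2$) if and only if $G$ is an induced subgraph of $K_{m,n,o}$ or of $T_n\vee(K_m+K_o)$ for some non-negative integers $m,n,o$.
   Context: $K_{m,n,o}$ is the complete tripartite graph with parts of sizes $m,n,o$; $T_n$ is the edgeless graph on $n$ vertices; $K_m$ the complete graph on $m$ vertices; $G+H$ is the disjoint union and $G\vee H$ the join (disjoint union plus all edges between $G$ and $H$). -}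

module Defs where

open import Level using (0ℓ)
open import Data.Bool.Base using (Bool; T)
open import Data.Empty using (⊥)
open import Data.Fin.Base using (Fin)
open import Data.Fin.Patterns using (0F; 1F; 2F; 3F; 4F)
open import Data.Fin.Properties using (_≟_)
open import Data.List.Base using (List; []; _∷_)
open import Data.List.Relation.Unary.All using (All)
open import Data.Nat.Base using (ℕ)
open import Data.Product.Base using (Σ-syntax; ∃-syntax; _×_; _,_; proj₁; proj₂)
open import Data.Product.Properties using (≡-dec)
open import Data.Sum.Base using (_⊎_; inj₁; inj₂; swap)
open import Data.Sum.Relation.Binary.Pointwise
  using (Pointwise; ⊎-symmetric; ⊎-decidable; inj₁; inj₂)
open import Data.Unit.Base using (⊤; tt)
open import Data.Vec.Base using (lookup; []; _∷_)
open import Function.Base using (_∘_; _on_)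
open import Function.Bundles using (_↔_; _⇔_; Inverse)
open import Relation.Binary.Construct.Closure.ReflexiveTransitive using (Star)
open import Relation.Binary.Core using (Rel)
open import Relation.Binary.Definitions using (Symmetric; Irreflexive; Decidable)
open import Relation.Binary.PropositionalEquality
  using (_≡_; _≢_; refl; sym; ≢-sym)
open import Relation.Nullary using (¬_; no; yes)
open import Relation.Nullary.Decidable using (¬?; _×-dec_; _⊎-dec_)
import Data.List.Membership.DecPropositional as DecMembership

-- Simple graphs.  Adjacency is decidable, which for finite graphs is no
-- restriction classically.  Finiteness is a separate predicate.
record Graph : Set₁ where
  infix 4 _~_ _~?_
  field
    V      : Set
    _~_    : Rel V 0ℓ
    ~-sym  : Symmetric _~_
    ~-irr  : Irreflexive _≡_ _~_
    _~?_   : Decidable _~_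

open Graph using (V)

Finite : Graph → Set
Finite G = ∃[ n ] (V G ↔ Fin n)

-- The graph without vertices counts as connected.
Connected : Graph → Set
Connected G = ∀ u v → Star (Graph._~_ G) u v

infix 4 _≅_ _InducedSubgraphOf_
infixl 9 _[_]

record _≅_ (G H : Graph) : Set where
  private
    module G = Graph G
    module H = Graph H
  field
    bijection : G.V ↔ H.V
  open Inverse bijection public using (to; from)
  field
    adjacency : ∀ {u v} → u G.~ v ⇔ to u H.~ to v

-- The subgraph of G induced by a set of vertices, given by its characteristic
-- function (so that membership proofs are unique).
_[_] : (G : Graph) → (V G → Bool) → Graph
G [ S ] = record
  { V     = Σ[ v ∈ G.V ] T (S v)
  ; _~_   = G._~_ on proj₁
  ; ~-sym = G.~-sym
  ; ~-irr = λ { refl → G.~-irr refl }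
  ; _~?_  = λ u v → proj₁ u G.~? proj₁ v
  }
  where module G = Graph G

-- As usual for unlabelled graphs, up to isomorphism.
_InducedSubgraphOf_ : Graph → Graph → Set
H InducedSubgraphOf G = ∃[ S ] (G [ S ] ≅ H)

_-Free : List Graph → Graph → Set₁
(𝓕 -Free) G = All (λ F → ¬ (F InducedSubgraphOf G)) 𝓕

K : ℕ → Graph
K n = record
  { V     = Fin n
  ; _~_   = _≢_
  ; ~-sym = ≢-sym
  ; ~-irr = λ u≡v u≢v → u≢v u≡v
  ; _~?_  = λ u v → ¬? (u ≟ v)
  }

Edgeless : ℕ → Graph
Edgeless n = record
  { V     = Fin n
  ; _~_   = λ _ _ → ⊥
  ; ~-sym = λ ()
  ; ~-irr = λ _ ()
  ; _~?_  = λ _ _ → no λ ()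
  }

-- A vertex is a pair (i , x) of an index i of a part and a member x of that part.
K⟨_,_,_⟩ : ℕ → ℕ → ℕ → Graph
K⟨ m , n , o ⟩ = record
  { V     = Σ[ i ∈ Fin 3 ] Fin (lookup (m ∷ n ∷ o ∷ []) i)
  ; _~_   = _≢_ on proj₁
  ; ~-sym = ≢-sym
  ; ~-irr = λ { refl i≢i → i≢i refl }
  ; _~?_  = λ u v → ¬? (proj₁ u ≟ proj₁ v)
  }

infixl 6 _⊍_
infixl 5 _∨_

_⊍_ : Graph → Graph → Graph
G ⊍ H = record
  { V     = G.V ⊎ H.V
  ; _~_   = Pointwise G._~_ H._~_
  ; ~-sym = ⊎-symmetric G.~-sym H.~-sym
  ; ~-irr = λ { refl (inj₁ p) → G.~-irr refl p
              ; refl (inj₂ p) → H.~-irr refl p }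
  ; _~?_  = ⊎-decidable G._~?_ H._~?_
  }
  where
  module G = Graph G
  module H = Graph H

_∨_ : Graph → Graph → Graph
G ∨ H = record
  { V     = G.V ⊎ H.V
  ; _~_   = _~_
  ; ~-sym = λ {u} {v} → ~-sym u v
  ; ~-irr = λ {u} {v} → ~-irr u v
  ; _~?_  = _~?_
  }
  where
  module G = Graph G
  module H = Graph H

  _~_ : Rel (G.V ⊎ H.V) 0ℓ
  inj₁ u ~ inj₁ v = u G.~ v
  inj₁ _ ~ inj₂ _ = ⊤
  inj₂ _ ~ inj₁ _ = ⊤
  inj₂ u ~ inj₂ v = u H.~ v

  ~-sym : ∀ u v → u ~ v → v ~ u
  ~-sym (inj₁ _) (inj₁ _) = G.~-sym
  ~-sym (inj₁ _) (inj₂ _) = λ _ → tt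
  ~-sym (inj₂ _) (inj₁ _) = λ _ → tt
  ~-sym (inj₂ _) (inj₂ _) = H.~-sym

  ~-irr : ∀ u v → u ≡ v → ¬ (u ~ v)
  ~-irr (inj₁ _) _ refl = G.~-irr refl
  ~-irr (inj₂ _) _ refl = H.~-irr refl

  _~?_ : Decidable _~_
  inj₁ u ~? inj₁ v = u G.~? v
  inj₁ _ ~? inj₂ _ = yes tt
  inj₂ _ ~? inj₁ _ = yes tt
  inj₂ u ~? inj₂ v = u H.~? v

-- Lists of unordered pairs of vertices: (u , v) and (v , u) denote the same edge.
EdgeList : ℕ → Set
EdgeList n = List (Fin n × Fin n)

module _ {n : ℕ} where
  open DecMembership (≡-dec (_≟_ {n}) (_≟_ {n})) using (_∈_; _∈?_)

  Listed : EdgeList n → Rel (Fin n) 0ℓ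
  Listed E u v = (u , v) ∈ E ⊎ (v , u) ∈ E

  Listed? : ∀ E → Decidable (Listed E)
  Listed? E u v = ((u , v) ∈? E) ⊎-dec ((v , u) ∈? E)

fromEdges : (n : ℕ) → EdgeList n → Graph
fromEdges n E = record
  { V     = Fin n
  ; _~_   = λ u v → u ≢ v × Listed E u v
  ; ~-sym = λ (u≢v , e) → ≢-sym u≢v , swap e
  ; ~-irr = λ u≡v (u≢v , _) → u≢v u≡v
  ; _~?_  = λ u v → ¬? (u ≟ v) ×-dec Listed? E u v
  }

-- The complete graph on n vertices with the edges in E removed.
K∖ : (n : ℕ) → EdgeList n → Graph
K∖ n E = record
  { V     = Fin n
  ; _~_   = λ u v → u ≢ v × ¬ Listed E u v
  ; ~-sym = λ (u≢v , ¬e) → ≢-sym u≢v , ¬e ∘ swap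
  ; ~-irr = λ u≡v (u≢v , _) → u≢v u≡v
  ; _~?_  = λ u v → ¬? (u ≟ v) ×-dec ¬? (Listed? E u v)
  }

P₄ : Graph
P₄ = fromEdges 4 ((0F , 1F) ∷ (1F , 2F) ∷ (2F , 3F) ∷ [])

K₅∖S₂ : Graph
K₅∖S₂ = K∖ 5 ((0F , 1F) ∷ (1F , 2F) ∷ [])

K₆∖M₂ : Graph
K₆∖M₂ = K∖ 6 ((0F , 1F) ∷ (2F , 3F) ∷ [])

-- On vertices 1,…,5 (here numbered from 0), the edges 23, 24, 34, 14, 45.
cricket : Graph
cricket = fromEdges 5
  ((1F , 2F) ∷ (1F , 3F) ∷ (2F , 3F) ∷ (0F , 3F) ∷ (3F , 4F) ∷ [])

-- Numbered likewise, the edges 12, 14, 23, 24, 34, 45.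
dart : Graph
dart = fromEdges 5
  ((0F , 1F) ∷ (0F , 3F) ∷ (1F , 2F) ∷ (1F , 3F) ∷ (2F , 3F) ∷ (3F , 4F) ∷ [])

𝓕₂ : List Graph
𝓕₂ = P₄ ∷ K₅∖S₂ ∷ K₆∖M₂ ∷ cricket ∷ dart ∷ []

-- Membership in either family is a colouring of the vertices by three colours
-- such that adjacency of distinct vertices is determined by their colours.  Such
-- colourings pull back along embeddings, and a finite search shows that no
-- member of 𝓕₂ has one.
--
-- Conversely, let G be 𝓕₂-free and consider its complement.  If the complement
-- is a disjoint union of cliques, K₆∖M₂-freeness bounds the number of cliques
-- when two of them are non-trivial.  Otherwise the complement has an induced
-- path a b c.  Connectedness of G and P₄-freeness give a vertex n outside the
-- component of b in the complement.  K₅∖S₂-freeness makes the vertices outside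
-- that component a clique of the complement; with n as the additional vertex,
-- cricket- and dart-freeness rule out triangles in the component, which is then
-- complete bipartite because it has no induced P₄.

module Submission where

open import Defs
open import Level using (0ℓ)
open import Data.Bool.Base using (Bool; true; false; not; T)
open import Data.Bool.Properties as Bool using (T-irrelevant)
open import Data.Empty using (⊥; ⊥-elim)
open import Data.Fin.Base using (Fin; _<_; finToFun; funToFin)
open import Data.Fin.Patterns using (0F; 1F; 2F)
open import Data.Fin.Properties using (_≟_; any?; all?; <-cmp; finToFun-funToFin)
open import Data.List.Base as List using (List; []; _∷_)
open import Data.List.Relation.Unary.All as All using (All; []; _∷_)
open import Data.List.Relation.Unary.All.Properties using (tabulate⁻)
open import Data.List.Relation.Unary.Any using (here; there)
open import Data.List.Membership.Propositional using (_∈_)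
open import Data.Nat.Base using (ℕ; _^_; s<s)
open import Data.Product.Base using (∃-syntax; Σ-syntax; _×_; _,_; proj₁; proj₂)
import Data.Product.Properties as Product
open import Data.Sum.Base as Sum using (_⊎_; inj₁; inj₂)
import Data.Sum.Properties as Sum
open import Data.Sum.Relation.Binary.Pointwise using (inj₁; inj₂)
open import Data.Vec.Base using (Vec; []; _∷_; lookup; allFin)
open import Data.Vec.Properties using (lookup-allFin)
open import Data.Vec.Relation.Unary.All using ([]; _∷_)
open import Data.Vec.Relation.Unary.All.Properties using (lookup⁺)
open import Data.Vec.Relation.Unary.AllPairs using (AllPairs; []; _∷_)
open import Function.Base using (_∘_)
open import Function.Bundles using (_⇔_; _↔_; Inverse; Injection; Equivalence; mk⇔; mk↔ₛ′)
open import Function.Construct.Identity using (↔-id)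
open import Function.Properties.Inverse using (↔⇒↣; ↔-sym)
open import Relation.Binary.Construct.Closure.ReflexiveTransitive using (Star; ε; _◅_)
open import Relation.Binary.Core using (Rel)
open import Relation.Binary.Definitions
  using (Symmetric; DecidableEquality; tri<; tri≈; tri>)
open import Relation.Binary.PropositionalEquality
  using (_≡_; _≢_; refl; sym; trans; cong; cong₂; subst; subst₂; ≢-sym)
open import Relation.Nullary using (¬_; Dec; does; yes; no; contradiction)
open import Relation.Nullary.Decidable
  using (¬?; _×-dec_; _→-dec_; map′; dec-true; dec-false; decidable-stable;
         via-injection; ⌊_⌋; True; toWitness; fromWitness; from-no)

open Graph using (V)

-- Adjacency and non-adjacency of distinct vertices

module Adjacency (G : Graph) where
  open Graph G public hiding (V)

  infix 4 _≁_

  _≁_ : Rel (V G) 0ℓ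
  u ≁ v = u ≢ v × ¬ u ~ v

  adjacent : V G → V G → Bool
  adjacent u v = does (u ~? v)

  -- Indexing by a Boolean lets the adjacency table of a concrete graph evaluate to the required
  -- relations. Both values force distinctness, so maps that respect the table are injective.
  Agrees : Bool → Rel (V G) 0ℓ
  Agrees true  = _~_
  Agrees false = _≁_

  ≁-sym : Symmetric _≁_
  ≁-sym (u≢v , ¬uv) = ≢-sym u≢v , ¬uv ∘ ~-sym

  ~⇒≢ : ∀ {u v} → u ~ v → u ≢ v
  ~⇒≢ uv u≡v = ~-irr u≡v uv

  ¬≁⇒~ : ∀ {u v} → u ≢ v → ¬ u ≁ v → u ~ v
  ¬≁⇒~ {u} {v} u≢v ¬u≁v = decidable-stable (u ~? v) λ ¬uv → ¬u≁v (u≢v , ¬uv)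

  Agrees-sym : ∀ b → Symmetric (Agrees b)
  Agrees-sym true  = ~-sym
  Agrees-sym false = ≁-sym

  Agrees⇒≢ : ∀ b {u v} → Agrees b u v → u ≢ v
  Agrees⇒≢ true  = ~⇒≢
  Agrees⇒≢ false = proj₁

  Agrees⇒≡ : ∀ b {u v} → Agrees b u v → adjacent u v ≡ b
  Agrees⇒≡ true  {u} {v} = dec-true (u ~? v)
  Agrees⇒≡ false {u} {v} = dec-false (u ~? v) ∘ proj₂

-- Search through finite sets

module _ {A : Set} {n : ℕ} (A↔Fin : A ↔ Fin n) where
  private module I = Inverse A↔Fin

  finite-≟ : DecidableEquality A
  finite-≟ = via-injection (↔⇒↣ A↔Fin) _≟_

  search : {P : A → Set} → (∀ v → Dec (P v)) → Dec (∃[ v ] P v)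
  search {P} P? = map′ (λ (i , p) → I.from i , p)
    (λ (v , p) → I.to v , subst P (sym (I.strictlyInverseʳ v)) p)
    (any? (P? ∘ I.from))

  enumeration : List A
  enumeration = List.tabulate I.from

  All-enumeration : {P : A → Set} → All P enumeration → ∀ v → P v
  All-enumeration {P} ps v = subst P (I.strictlyInverseʳ v) (tabulate⁻ ps (I.to v))

-- Embeddings as induced subgraphs

record Embedding (F G : Graph) : Set where
  constructor _,_
  open Adjacency F using (adjacent)
  open Adjacency G using (Agrees)
  field
    map    : V F → V G
    agrees : ∀ {i j} → i ≢ j → Agrees (adjacent i j) (map i) (map j)

⊆⇒Embedding : ∀ {F G} → F InducedSubgraphOf G → Embedding F G
⊆⇒Embedding {F} {G} (S , iso) = proj₁ ∘ from , agrees
  where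
  module F = Adjacency F
  module G = Adjacency G
  open _≅_ iso
  to-from = Inverse.strictlyInverseˡ bijection

  from-injective : ∀ {i j} → proj₁ (from i) ≡ proj₁ (from j) → i ≡ j
  from-injective {i} {j} eq = trans (sym (to-from i)) (trans (cong to (Σ-≡ eq)) (to-from j))
    where
    Σ-≡ : {x y : V (G [ S ])} → proj₁ x ≡ proj₁ y → x ≡ y
    Σ-≡ refl = cong (_ ,_) (T-irrelevant _ _)

  agrees : ∀ {i j} → i ≢ j → G.Agrees (F.adjacent i j) (proj₁ (from i)) (proj₁ (from j))
  agrees {i} {j} i≢j with i F.~? j
  ... | yes ij = Equivalence.from adjacency (subst₂ F._~_ (sym (to-from i)) (sym (to-from j)) ij)
  ... | no ¬ij = i≢j ∘ from-injective ,
    λ uv → ¬ij (subst₂ F._~_ (to-from i) (to-from j) (Equivalence.to adjacency uv))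

Embedding⇒⊆ : ∀ {F G k} → V F ↔ Fin k → DecidableEquality (V G) → Embedding F G → F InducedSubgraphOf G
Embedding⇒⊆ {F} {G} V↔Fin _≟ᴳ_ (f , agrees) = (λ w → ⌊ image? w ⌋) , record
  { bijection = mk↔ₛ′ preimage image preimage-image image-preimage
  ; adjacency = λ {u} {v} → mk⇔
      (λ uv → reflect (subst₂ G._~_ (sym (preimage-≡ u)) (sym (preimage-≡ v)) uv))
      (λ ij → subst₂ G._~_ (preimage-≡ u) (preimage-≡ v) (preserve ij))
  }
  where
  module F = Adjacency F
  module G = Adjacency G

  image? : ∀ w → Dec (∃[ i ] f i ≡ w)
  image? w = search V↔Fin λ i → f i ≟ᴳ w

  Image : Set
  Image = Σ[ w ∈ V G ] True (image? w)

  preimage : Image → V F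
  preimage (w , p) = proj₁ (toWitness {a? = image? w} p)

  preimage-≡ : ∀ u → f (preimage u) ≡ proj₁ u
  preimage-≡ (w , p) = proj₂ (toWitness {a? = image? w} p)

  image : V F → Image
  image i = f i , fromWitness {a? = image? (f i)} (i , refl)

  f-injective : ∀ {i j} → f i ≡ f j → i ≡ j
  f-injective {i} {j} eq = decidable-stable (finite-≟ V↔Fin i j)
    λ i≢j → G.Agrees⇒≢ (F.adjacent i j) (agrees i≢j) eq

  preimage-image : ∀ i → preimage (image i) ≡ i
  preimage-image i = f-injective (preimage-≡ (image i))

  image-preimage : ∀ u → image (preimage u) ≡ u
  image-preimage u = Σ-≡ (preimage-≡ u)
    where
    Σ-≡ : {x y : Image} → proj₁ x ≡ proj₁ y → x ≡ y
    Σ-≡ refl = cong (_ ,_) (T-irrelevant _ _)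

  preserve : ∀ {i j} → i F.~ j → f i G.~ f j
  preserve {i} {j} ij = subst (λ b → G.Agrees b (f i) (f j)) (dec-true (i F.~? j) ij)
    (agrees (F.~⇒≢ ij))

  reflect : ∀ {i j} → f i G.~ f j → i F.~ j
  reflect {i} {j} uv with i F.~? j | agrees {i} {j} (G.~⇒≢ uv ∘ cong f)
  ... | yes ij | _         = ij
  ... | no _   | _ , ¬uv = contradiction uv ¬uv

AllPairs-lookup : ∀ {A : Set} {R : Rel A 0ℓ} {n} {xs : Vec A n} → AllPairs R xs →
  ∀ {i j} → i < j → R (lookup xs i) (lookup xs j)
AllPairs-lookup (rs ∷ _)  {0F}        {Fin.suc j} _         = lookup⁺ rs j
AllPairs-lookup (_  ∷ ps) {Fin.suc i} {Fin.suc j} (s<s i<j) = AllPairs-lookup ps i<j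

-- Colour patterns

Pattern : Set
Pattern = Fin 3 → Fin 3 → Bool

-- The diagonal of `t` tells which colour classes are cliques and which are independent sets; hence
-- the restriction to distinct vertices.
record Colouring (t : Pattern) (G : Graph) : Set where
  constructor _,_
  open Adjacency G using (adjacent)
  field
    colour : V G → Fin 3
    proper : ∀ {u v} → u ≢ v → t (colour u) (colour v) ≡ adjacent u v

tripartite : Pattern
tripartite i j = not (does (i ≟ j))

-- 0 is the colour of the edgeless side, 1 and 2 are those of the two cliques.
edgeless∨cliques : Pattern
edgeless∨cliques 0F 0F = false
edgeless∨cliques 1F 2F = false
edgeless∨cliques 2F 1F = false
edgeless∨cliques _  _  = true

Colouring-pullback : ∀ {t F G} → Embedding F G → Colouring t G → Colouring t F
Colouring-pullback {F = F} {G} (f , agrees) (c , proper) = c ∘ f , λ {i} {j} i≢j →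
  let a = agrees i≢j; b = F.adjacent i j in
  trans (proper (G.Agrees⇒≢ b a)) (G.Agrees⇒≡ b a)
  where
  module F = Adjacency F
  module G = Adjacency G

K⟨⟩-Colouring : ∀ {m n o} → Colouring tripartite K⟨ m , n , o ⟩
K⟨⟩-Colouring = proj₁ , λ _ → refl

∨⊍-Colouring : ∀ {m n o} → Colouring edgeless∨cliques (Edgeless n ∨ (K m ⊍ K o))
∨⊍-Colouring {m} {n} {o} = colour , λ {u} {v} → proper u v
  where
  H = Edgeless n ∨ (K m ⊍ K o)
  open Adjacency H using (adjacent)

  colour : V H → Fin 3
  colour (inj₁ _)        = 0F
  colour (inj₂ (inj₁ _)) = 1F
  colour (inj₂ (inj₂ _)) = 2F

  proper : ∀ u v → u ≢ v → edgeless∨cliques (colour u) (colour v) ≡ adjacent u v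
  proper (inj₁ _)        (inj₁ _)        _   = refl
  proper (inj₁ _)        (inj₂ (inj₁ _)) _   = refl
  proper (inj₁ _)        (inj₂ (inj₂ _)) _   = refl
  proper (inj₂ (inj₁ _)) (inj₁ _)        _   = refl
  proper (inj₂ (inj₂ _)) (inj₁ _)        _   = refl
  proper (inj₂ (inj₁ x)) (inj₂ (inj₁ y)) u≢v =
    sym (cong not (dec-false (x ≟ y) (λ { refl → u≢v refl })))
  proper (inj₂ (inj₁ _)) (inj₂ (inj₂ _)) _   = refl
  proper (inj₂ (inj₂ _)) (inj₂ (inj₁ _)) _   = refl
  proper (inj₂ (inj₂ x)) (inj₂ (inj₂ y)) u≢v =
    sym (cong not (dec-false (x ≟ y) (λ { refl → u≢v refl })))

-- The colour class of a vertex u together with its number in G determine its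
-- image, so parts of size |V G| suffice.
Colouring⇒Embedding : ∀ {t G H n} (V↔Fin : V G ↔ Fin n) (place : Fin 3 → Fin n → V H) →
  (∀ i j {x y} → x ≢ y → Adjacency.Agrees H (t i j) (place i x) (place j y)) →
  Colouring t G → Embedding G H
Colouring⇒Embedding {G = G} {H} V↔Fin place agrees (c , proper) =
  (λ u → place (c u) (to u)) , λ {u} {v} u≢v →
    subst (λ b → H.Agrees b (place (c u) (to u)) (place (c v) (to v))) (proper u≢v)
      (agrees (c u) (c v) (u≢v ∘ injective))
  where
  module H = Adjacency H
  open Inverse V↔Fin using (to)
  injective = Injection.injective (↔⇒↣ V↔Fin)

Colouring⇒⊆K⟨⟩ : ∀ {G n} → V G ↔ Fin n → Colouring tripartite G →
  G InducedSubgraphOf K⟨ n , n , n ⟩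
Colouring⇒⊆K⟨⟩ {n = n} V↔Fin col = Embedding⇒⊆ V↔Fin (Product.≡-dec _≟_ _≟_)
  (Colouring⇒Embedding V↔Fin place agrees col)
  where
  H = K⟨ n , n , n ⟩
  open Adjacency H using (Agrees)

  place : Fin 3 → Fin n → V H
  place 0F x = 0F , x
  place 1F x = 1F , x
  place 2F x = 2F , x

  agrees : ∀ i j {x y} → x ≢ y → Agrees (tripartite i j) (place i x) (place j y)
  agrees 0F 0F x≢y = (λ { refl → x≢y refl }) , λ i≢i → i≢i refl
  agrees 0F 1F _   = λ ()
  agrees 0F 2F _   = λ ()
  agrees 1F 0F _   = λ ()
  agrees 1F 1F x≢y = (λ { refl → x≢y refl }) , λ i≢i → i≢i refl
  agrees 1F 2F _   = λ ()
  agrees 2F 0F _   = λ ()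
  agrees 2F 1F _   = λ ()
  agrees 2F 2F x≢y = (λ { refl → x≢y refl }) , λ i≢i → i≢i refl

Colouring⇒⊆∨⊍ : ∀ {G n} → V G ↔ Fin n → Colouring edgeless∨cliques G →
  G InducedSubgraphOf (Edgeless n ∨ (K n ⊍ K n))
Colouring⇒⊆∨⊍ {n = n} V↔Fin col = Embedding⇒⊆ V↔Fin (Sum.≡-dec _≟_ (Sum.≡-dec _≟_ _≟_))
  (Colouring⇒Embedding V↔Fin place agrees col)
  where
  H = Edgeless n ∨ (K n ⊍ K n)
  open Adjacency H using (Agrees)

  place : Fin 3 → Fin n → V H
  place 0F x = inj₁ x
  place 1F x = inj₂ (inj₁ x)
  place 2F x = inj₂ (inj₂ x)

  agrees : ∀ i j {x y} → x ≢ y → Agrees (edgeless∨cliques i j) (place i x) (place j y)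
  agrees 0F 0F x≢y = (λ { refl → x≢y refl }) , λ ()
  agrees 0F 1F _   = _
  agrees 0F 2F _   = _
  agrees 1F 0F _   = _
  agrees 1F 1F x≢y = inj₁ x≢y
  agrees 1F 2F _   = (λ ()) , λ ()
  agrees 2F 0F _   = _
  agrees 2F 1F _   = (λ ()) , λ ()
  agrees 2F 2F x≢y = inj₂ x≢y

-- Members of `𝓕₂` have no colouring

Colouring? : ∀ t {G n} → V G ↔ Fin n → Dec (Colouring t G)
Colouring? t {G} {n} V↔Fin = map′
  (λ (x , p) → finToFun x ∘ to , λ {u} {v} u≢v → trans (p (to u) (to v) (u≢v ∘ injective))
    (cong₂ adjacent (strictlyInverseʳ u) (strictlyInverseʳ v)))
  (λ (c , p) → funToFin (c ∘ from) , λ i j i≢j → trans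
    (cong₂ t (finToFun-funToFin (c ∘ from) i) (finToFun-funToFin (c ∘ from) j))
    (p (i≢j ∘ from-injective)))
  -- `Fin (3 ^ n)` codes all maps from `Fin n` to `Fin 3`, which leaves at most 729 candidates for a
  -- member of `𝓕₂`.
  (any? {n = 3 ^ n} λ x → all? λ i → all? λ j →
    ¬? (i ≟ j) →-dec (t (finToFun x i) (finToFun x j) Bool.≟ adjacent (from i) (from j)))
  where
  open Adjacency G using (adjacent)
  open Inverse V↔Fin using (to; from; strictlyInverseˡ; strictlyInverseʳ)
  injective = Injection.injective (↔⇒↣ V↔Fin)

  from-injective : ∀ {i j} → from i ≡ from j → i ≡ j
  from-injective {i} {j} eq =
    trans (sym (strictlyInverseˡ i)) (trans (cong to eq) (strictlyInverseˡ j))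

Uncolourable : Pattern → List Graph → Set₁
Uncolourable t = All (λ F → ¬ Colouring t F)

𝓕₂-not-tripartite : Uncolourable tripartite 𝓕₂
𝓕₂-not-tripartite
  = from-no (Colouring? tripartite {P₄} (↔-id _))
  ∷ from-no (Colouring? tripartite {K₅∖S₂} (↔-id _))
  ∷ from-no (Colouring? tripartite {K₆∖M₂} (↔-id _))
  ∷ from-no (Colouring? tripartite {cricket} (↔-id _))
  ∷ from-no (Colouring? tripartite {dart} (↔-id _))
  ∷ []

𝓕₂-not-edgeless∨cliques : Uncolourable edgeless∨cliques 𝓕₂
𝓕₂-not-edgeless∨cliques
  = from-no (Colouring? edgeless∨cliques {P₄} (↔-id _))
  ∷ from-no (Colouring? edgeless∨cliques {K₅∖S₂} (↔-id _))
  ∷ from-no (Colouring? edgeless∨cliques {K₆∖M₂} (↔-id _))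
  ∷ from-no (Colouring? edgeless∨cliques {cricket} (↔-id _))
  ∷ from-no (Colouring? edgeless∨cliques {dart} (↔-id _))
  ∷ []

Uncolourable⇒Free : ∀ {t 𝓕 G} → Uncolourable t 𝓕 → Colouring t G → (𝓕 -Free) G
Uncolourable⇒Free []         _   = []
Uncolourable⇒Free {G = G} (¬F ∷ ¬𝓕) col =
  (λ F⊆G → ¬F (Colouring-pullback (⊆⇒Embedding {G = G} F⊆G) col)) ∷ Uncolourable⇒Free ¬𝓕 col

-- The structure of 𝓕₂-free graphs

module Free {G : Graph} {N : ℕ} (V↔Fin : V G ↔ Fin N) (free : (𝓕₂ -Free) G) where
  open Adjacency G

  private
    _≟ᵛ_ : DecidableEquality (V G)
    _≟ᵛ_ = finite-≟ V↔Fin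

  _≁?_ : ∀ u v → Dec (u ≁ v)
  u ≁? v = ¬? (u ≟ᵛ v) ×-dec ¬? (u ~? v)

  -- Only pairs of increasing indices are demanded, the others following by symmetry. Over
  -- `allFin k` the condition unfolds to the upper triangle of the adjacency matrix of `F`.
  absent : ∀ {F k} → F ∈ 𝓕₂ → (e : Fin k ↔ V F) → (vs : Vec (V G) k) →
    ¬ AllPairs (λ i j → Agrees (Adjacency.adjacent F (Inverse.to e i) (Inverse.to e j))
                               (lookup vs i) (lookup vs j)) (allFin k)
  absent {F} {k} F∈𝓕₂ e vs pairs =
    All.lookup free F∈𝓕₂ (Embedding⇒⊆ (↔-sym e) _≟ᵛ_ (f , λ {x} {y} → agrees x y))
    where
    module F = Adjacency F
    open Inverse e using (to; from; strictlyInverseˡ)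

    f : V F → V G
    f = lookup vs ∘ from

    R : Rel (Fin k) 0ℓ
    R i j = Agrees (F.adjacent (to i) (to j)) (lookup vs i) (lookup vs j)

    ordered : ∀ {i j} → i < j → R i j
    ordered {i} {j} i<j =
      subst₂ R (lookup-allFin i) (lookup-allFin j) (AllPairs-lookup pairs i<j)

    distinct : ∀ i j → i ≢ j → R i j
    distinct i j i≢j with <-cmp i j
    ... | tri< i<j _ _ = ordered i<j
    ... | tri≈ _ i≡j _ = contradiction i≡j i≢j
    ... | tri> _ _ j<i = Agrees-sym (F.adjacent (to i) (to j))
      (subst (λ b → Agrees b (lookup vs j) (lookup vs i)) adjacent-sym (ordered j<i))
      where
      adjacent-sym : F.adjacent (to j) (to i) ≡ F.adjacent (to i) (to j)
      adjacent-sym with to i F.~? to j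
      ... | yes ij = dec-true (to j F.~? to i) (F.~-sym ij)
      ... | no ¬ij = dec-false (to j F.~? to i) (¬ij ∘ F.~-sym)

    agrees : ∀ x y → x ≢ y → Agrees (F.adjacent x y) (f x) (f y)
    agrees x y x≢y = subst₂ (λ x′ y′ → Agrees (F.adjacent x′ y′) (f x) (f y))
      (strictlyInverseˡ x) (strictlyInverseˡ y)
      (distinct (from x) (from y) λ eq →
        x≢y (trans (sym (strictlyInverseˡ x)) (trans (cong to eq) (strictlyInverseˡ y))))

  -- Forbidden configurations

  no-P₄ : ∀ {p q r s} → p ~ q → q ~ r → r ~ s → ¬ p ~ r → ¬ p ~ s → ¬ q ~ s → ⊥
  no-P₄ {p} {q} {r} {s} pq qr rs ¬pr ¬ps ¬qs =
    absent {P₄} (here refl) (↔-id _) (p ∷ q ∷ r ∷ s ∷ [])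
    ( (pq ∷ ((λ { refl → ¬ps rs }) , ¬pr) ∷ ((λ { refl → ¬pr (~-sym rs) }) , ¬ps) ∷ [])
    ∷ (qr ∷ ((λ { refl → ¬ps pq }) , ¬qs) ∷ [])
    ∷ (rs ∷ [])
    ∷ [] ∷ [])

  -- `P₄` is self-complementary: the path p q r s of the complement is the path q s p r of `G`.
  no-co-P₄ : ∀ {p q r s} → p ≁ q → q ≁ r → r ≁ s → p ~ r → p ~ s → q ~ s → ⊥
  no-co-P₄ (_ , ¬pq) (_ , ¬qr) (_ , ¬rs) pr ps qs =
    no-P₄ qs (~-sym ps) pr (¬pq ∘ ~-sym) ¬qr (¬rs ∘ ~-sym)

  no-K₅∖S₂ : ∀ {a b c u v} → a ≁ b → b ≁ c → a ~ c →
    a ~ u → b ~ u → c ~ u → a ~ v → b ~ v → c ~ v → u ~ v → ⊥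
  no-K₅∖S₂ {a} {b} {c} {u} {v} ab bc ac au bu cu av bv cv uv =
    absent {K₅∖S₂} (there (here refl)) (↔-id _) (a ∷ b ∷ c ∷ u ∷ v ∷ [])
    ( (ab ∷ ac ∷ au ∷ av ∷ [])
    ∷ (bc ∷ bu ∷ bv ∷ [])
    ∷ (cu ∷ cv ∷ [])
    ∷ (uv ∷ [])
    ∷ [] ∷ [])

  no-K₆∖M₂ : ∀ {p q u v x y} → p ≁ q → u ≁ v → p ~ u → p ~ v → q ~ u → q ~ v →
    p ~ x → q ~ x → u ~ x → v ~ x → p ~ y → q ~ y → u ~ y → v ~ y → x ~ y → ⊥
  no-K₆∖M₂ {p} {q} {u} {v} {x} {y} pq uv pu pv qu qv px qx ux vx py qy uy vy xy =
    absent {K₆∖M₂} (there (there (here refl))) (↔-id _) (p ∷ q ∷ u ∷ v ∷ x ∷ y ∷ [])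
    ( (pq ∷ pu ∷ pv ∷ px ∷ py ∷ [])
    ∷ (qu ∷ qv ∷ qx ∷ qy ∷ [])
    ∷ (uv ∷ ux ∷ uy ∷ [])
    ∷ (vx ∷ vy ∷ [])
    ∷ (xy ∷ [])
    ∷ [] ∷ [])

  -- If w missed one or both of q and r, then p, q, r, w would induce a diamond
  -- or a paw in the complement, and with the vertex n a cricket or a dart in G.
  co-triangle-absorbs : ∀ {n p q r w} → n ~ p → n ~ q → n ~ r → n ~ w →
    p ≁ q → p ≁ r → q ≁ r → w ≁ p → w ≢ q → w ≁ q
  co-triangle-absorbs {n} {p} {q} {r} {w} np nq nr nw pq pr qr wp w≢q
    with w ~? q | w ≟ᵛ r | w ~? r
  ... | no ¬wq | _        | _      = w≢q , ¬wq
  ... | yes wq | yes refl | _      = contradiction (~-sym wq) (proj₂ qr)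
  ... | yes wq | no w≢r   | no ¬wr =
    ⊥-elim (absent {cricket} (there (there (there (here refl)))) (↔-id _) (p ∷ w ∷ q ∷ n ∷ r ∷ [])
      ( (≁-sym wp ∷ pq ∷ ~-sym np ∷ pr ∷ [])
      ∷ (wq ∷ ~-sym nw ∷ (w≢r , ¬wr) ∷ [])
      ∷ (~-sym nq ∷ qr ∷ [])
      ∷ (nr ∷ [])
      ∷ [] ∷ []))
  ... | yes wq | no _     | yes wr =
    ⊥-elim (absent {dart} (there (there (there (there (here refl))))) (↔-id _) (q ∷ w ∷ r ∷ n ∷ p ∷ [])
      ( (~-sym wq ∷ qr ∷ ~-sym nq ∷ ≁-sym pq ∷ [])
      ∷ (wr ∷ ~-sym nw ∷ wp ∷ [])
      ∷ (~-sym nr ∷ ≁-sym pr ∷ [])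
      ∷ (np ∷ [])
      ∷ [] ∷ []))

  -- Common and dominating neighbours

  -- By induction the tail of the walk shrinks to length at most 2. A remaining walk u w z v has a
  -- chord, since it would otherwise be an induced `P₄`, and each possible chord shortens it.
  diameter≤2 : ∀ {u v} → Star _~_ u v → u ≢ v → u ~ v ⊎ ∃[ z ] (u ~ z × z ~ v)
  diameter≤2 ε u≢u = contradiction refl u≢u
  diameter≤2 {u} {v} (_◅_ {j = w} uw wv) u≢v with w ≟ᵛ v
  ... | yes refl = inj₁ uw
  ... | no w≢v with diameter≤2 wv w≢v
  ...   | inj₁ wv′ = inj₂ (w , uw , wv′)
  ...   | inj₂ (z , wz , zv) with u ~? z | w ~? v | u ~? v
  ...     | yes uz | _      | _      = inj₂ (z , uz , zv)
  ...     | no _   | yes wv | _      = inj₂ (w , uw , wv)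
  ...     | no _   | no _   | yes uv = inj₁ uv
  ...     | no ¬uz | no ¬wv | no ¬uv = ⊥-elim (no-P₄ uw wz zv ¬uz ¬uv ¬wv)

  common-neighbour : Connected G → ∀ {u v} → u ≁ v → ∃[ z ] (u ~ z × z ~ v)
  common-neighbour conn {u} {v} (u≢v , ¬uv) with diameter≤2 (conn u v) u≢v
  ... | inj₁ uv = contradiction uv ¬uv
  ... | inj₂ z  = z

  -- P₄-freeness makes the sets of common neighbours of b with its various
  -- non-neighbours nested, so a smallest one is contained in all of them.
  dominating-neighbour : Connected G → ∀ {a b} → b ≁ a → ∃[ n ] (b ~ n × ∀ v → b ≁ v → n ~ v)
  dominating-neighbour conn {a} {b} ba =
    let n , bn , dom = dominate (enumeration V↔Fin) in n , bn , All-enumeration V↔Fin dom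
    where
    Dominates : V G → V G → Set
    Dominates n v = b ≁ v → n ~ v

    -- If n′ missed m′, there would be an induced `P₄`: m n′ b n when n and n′ are non-adjacent;
    -- otherwise m′ n n′ m or b n m′ m, according to whether m and m′ are non-adjacent or adjacent.
    nested : ∀ {n n′ m m′} → b ~ n → b ~ n′ → b ≁ m → b ≁ m′ →
      ¬ n ~ m → n ~ m′ → n′ ~ m → n′ ~ m′
    nested {n} {n′} {m} {m′} bn bn′ (_ , ¬bm) (_ , ¬bm′) ¬nm nm′ n′m =
      decidable-stable (n′ ~? m′) λ ¬n′m′ → case-⊥ ¬n′m′
      where
      case-⊥ : ¬ n′ ~ m′ → ⊥
      case-⊥ ¬n′m′ with n ~? n′ | m ~? m′
      ... | no ¬nn′ | _       =
        no-P₄ (~-sym n′m) (~-sym bn′) bn (¬bm ∘ ~-sym) (¬nm ∘ ~-sym) (¬nn′ ∘ ~-sym)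
      ... | yes nn′ | no ¬mm′ =
        no-P₄ (~-sym nm′) nn′ n′m (¬n′m′ ∘ ~-sym) (¬mm′ ∘ ~-sym) ¬nm
      ... | yes _   | yes mm′ =
        no-P₄ bn nm′ (~-sym mm′) ¬bm′ ¬bm ¬nm

    dominate : ∀ vs → ∃[ n ] (b ~ n × All (Dominates n) vs)
    dominate [] = let z , bz , _ = common-neighbour conn ba in z , bz , []
    dominate (m ∷ vs) with dominate vs
    ... | n , bn , dom with b ≁? m | n ~? m
    ...   | no ¬bm | _      = n , bn , (λ bm → contradiction bm ¬bm) ∷ dom
    ...   | yes _  | yes nm = n , bn , (λ _ → nm) ∷ dom
    -- The candidate n fails at m and is replaced by a common neighbour n′ of b and m; by `nested`,
    -- n′ still dominates everything that n did.
    ...   | yes bm | no ¬nm with common-neighbour conn bm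
    ...     | n′ , bn′ , n′m = n′ , bn′ , (λ _ → n′m) ∷
      All.map (λ nv bv → nested bn bn′ bm bv ¬nm (nv bv) n′m) dom

  colouring-by : ∀ t (P : Fin 3 → V G → Set) → (∀ u → ∃[ i ] P i u) →
    (∀ i j {u v} → u ≢ v → P i u → P j v → Agrees (t i j) u v) → Colouring t G
  colouring-by t P class fits = proj₁ ∘ class , λ {u} {v} u≢v →
    sym (Agrees⇒≡ _ (fits _ _ u≢v (proj₂ (class u)) (proj₂ (class v))))

  -- Complement a disjoint union of cliques

  module Non-adjacency-transitive (no-co-P₃ : ∀ {a b c} → a ≁ b → b ≁ c → ¬ a ~ c) where

    ¬~-trans : ∀ {u v w} → ¬ u ~ v → ¬ v ~ w → ¬ u ~ w
    ¬~-trans {u} {v} {w} ¬uv ¬vw with u ≟ᵛ v | v ≟ᵛ w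
    ... | yes refl | _        = ¬vw
    ... | no _     | yes refl = ¬uv
    ... | no u≢v   | no v≢w   = no-co-P₃ (u≢v , ¬uv) (v≢w , ¬vw)

    -- Non-adjacency is an equivalence relation here, so its classes consist of vertices with equal
    -- neighbourhoods.
    ~-shift : ∀ {u v w} → ¬ u ~ v → u ~ w → v ~ w
    ~-shift {u} {v} {w} ¬uv uw = decidable-stable (v ~? w) λ ¬vw → ¬~-trans ¬uv ¬vw uw

    same-class : ∀ {p u v} → ¬ p ~ u → ¬ p ~ v → ¬ u ~ v
    same-class ¬pu ¬pv = ¬~-trans (¬pu ∘ ~-sym) ¬pv

    -- The cases are the number of non-trivial classes of non-adjacency. With none, `G` is complete.
    -- With exactly one, that class is the edgeless side and the other vertices form a single
    -- clique. With two, the classes of p and u are two parts and the rest is the third.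
    colouring : Colouring tripartite G ⊎ Colouring edgeless∨cliques G
    colouring with search V↔Fin (λ p → search V↔Fin (p ≁?_))
    ... | no ¬≁ = inj₂ ((λ _ → 1F) , λ {u} {v} u≢v →
      sym (dec-true (u ~? v) (¬≁⇒~ u≢v λ uv → ¬≁ (u , v , uv))))
    ... | yes (p , q , pq) with search V↔Fin (λ u → search V↔Fin λ v → p ~? u ×-dec u ≁? v)
    ...   | no ¬uv = inj₂ (colouring-by edgeless∨cliques Class class fits)
      where
      Class : Fin 3 → V G → Set
      Class 0F u = ¬ p ~ u
      Class 1F u = p ~ u
      Class 2F _ = ⊥

      class : ∀ u → ∃[ i ] Class i u
      class u with p ~? u
      ... | yes pu = 1F , pu
      ... | no ¬pu = 0F , ¬pu

      fits : ∀ i j {u v} → u ≢ v → Class i u → Class j v → Agrees (edgeless∨cliques i j) u v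
      fits 0F 0F u≢v ¬pu ¬pv = u≢v , same-class ¬pu ¬pv
      fits 0F 1F _   ¬pu pv  = ~-shift ¬pu pv
      fits 1F 0F _   pu  ¬pv = ~-sym (~-shift ¬pv pu)
      fits 1F 1F u≢v pu  pv  = ¬≁⇒~ u≢v λ uv → ¬uv (_ , _ , pu , uv)
      fits 0F 2F _ _ ()
      fits 1F 2F _ _ ()
      fits 2F _  _ ()
    ...   | yes (u , v , pu , uv) = inj₁ (colouring-by tripartite Class class fits)
      where
      Class : Fin 3 → V G → Set
      Class 0F x = ¬ p ~ x
      Class 1F x = ¬ u ~ x
      Class 2F x = p ~ x × u ~ x

      class : ∀ x → ∃[ i ] Class i x
      class x with p ~? x | u ~? x
      ... | no ¬px | _      = 0F , ¬px
      ... | yes _  | no ¬ux = 1F , ¬ux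
      ... | yes px | yes ux = 2F , px , ux

      fits : ∀ i j {x y} → x ≢ y → Class i x → Class j y → Agrees (tripartite i j) x y
      fits 0F 0F x≢y ¬px ¬py = x≢y , same-class ¬px ¬py
      fits 0F 1F _   ¬px ¬uy = ~-shift ¬px (~-sym (~-shift ¬uy (~-sym pu)))
      fits 0F 2F _   ¬px (py , _) = ~-shift ¬px py
      fits 1F 1F x≢y ¬ux ¬uy = x≢y , same-class ¬ux ¬uy
      fits 1F 2F _   ¬ux (_ , uy) = ~-shift ¬ux uy
      -- Adjacent x and y outside both classes would complete the non-adjacent pairs p, q and u, v
      -- to `K₆∖M₂`.
      fits 2F 2F x≢y (px , ux) (py , uy) = x≢y , no-K₆∖M₂ pq uv pu pv (shift-p pu) (shift-p pv)
        px (shift-p px) ux (shift-u ux) py (shift-p py) uy (shift-u uy)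
        where
        shift-p : ∀ {w} → p ~ w → q ~ w
        shift-p = ~-shift (proj₂ pq)
        shift-u : ∀ {w} → u ~ w → v ~ w
        shift-u = ~-shift (proj₂ uv)
        pv : p ~ v
        pv = ~-sym (shift-u (~-sym pu))
      fits 1F 0F x≢y cx cy = ~-sym (fits 0F 1F (≢-sym x≢y) cy cx)
      fits 2F 0F x≢y cx cy = ~-sym (fits 0F 2F (≢-sym x≢y) cy cx)
      fits 2F 1F x≢y cx cy = ~-sym (fits 1F 2F (≢-sym x≢y) cy cx)

  -- Complement with an induced path a b c

  module Co-P₃ (conn : Connected G) {a b c} (ab : a ≁ b) (bc : b ≁ c) (ac : a ~ c) where

    -- Classes `1F` and `2F` turn out to be the two sides of the component of b in the complement.
    -- The vertex b itself lies in `1F`, while a and c lie in `2F`.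
    Class : Fin 3 → V G → Set
    Class 0F u = u ~ a × u ~ b
    Class 1F u = u ≁ a × ¬ u ≁ b
    Class 2F u = u ≁ b

    class : ∀ u → ∃[ i ] Class i u
    class u with u ≁? b | u ≁? a | u ≟ᵛ a | u ≟ᵛ b
    ... | yes ub | _      | _        | _        = 2F , ub
    ... | no ¬ub | yes ua | _        | _        = 1F , ua , ¬ub
    ... | no ¬ub | no _   | yes refl | _        = contradiction ab ¬ub
    ... | no _   | no ¬ua | no _     | yes refl = contradiction (≁-sym ab) ¬ua
    ... | no ¬ub | no ¬ua | no u≢a   | no u≢b   = 0F , ¬≁⇒~ u≢a ¬ua , ¬≁⇒~ u≢b ¬ub

    private
      n : V G
      -- This vertex belongs to class `0F`; it is the extra vertex in every use of
      -- `co-triangle-absorbs` below.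
      n = proj₁ (dominating-neighbour conn bc)

      n~b : n ~ b
      n~b = ~-sym (proj₁ (proj₂ (dominating-neighbour conn bc)))

      n~ : ∀ {v} → v ≁ b → n ~ v
      n~ vb = proj₂ (proj₂ (dominating-neighbour conn bc)) _ (≁-sym vb)

    -- Otherwise u c b a would be an induced path of the complement.
    ~-c : ∀ {u} → Class 0F u → u ~ c
    ~-c {u} (ua , ub) = ¬≁⇒~ (λ { refl → proj₂ bc (~-sym ub) })
      λ uc → no-co-P₄ uc (≁-sym bc) (≁-sym ab) ub ua (~-sym ac)

    fits₀₀ : ∀ {u v} → u ≢ v → Class 0F u → Class 0F v → u ≁ v
    fits₀₀ u≢v cu@(ua , ub) cv@(va , vb) = u≢v , no-K₅∖S₂ ab bc ac
      (~-sym ua) (~-sym ub) (~-sym (~-c cu)) (~-sym va) (~-sym vb) (~-sym (~-c cv))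

    fits₀₁ : ∀ {u v} → u ≢ v → Class 0F u → Class 1F v → u ~ v
    fits₀₁ {u} {v} u≢v (ua , ub) (va , ¬vb) with v ≟ᵛ b
    ... | yes refl = ub
    ... | no v≢b   = ¬≁⇒~ u≢v λ uv → no-co-P₄ uv va ab ua ub (¬≁⇒~ v≢b ¬vb)

    -- The dominating vertex n settles u = n. For any other u, a non-adjacent v would give the
    -- induced path n u v b of the complement, as n and u are non-adjacent by `fits₀₀`.
    fits₀₂ : ∀ {u v} → u ≢ v → Class 0F u → Class 2F v → u ~ v
    fits₀₂ {u} {v} u≢v cu@(_ , ub) vb with n ≟ᵛ u
    ... | yes refl = n~ vb
    ... | no n≢u   = ¬≁⇒~ u≢v λ uv →
      no-co-P₄ (fits₀₀ n≢u (n~ ab , n~b) cu) uv vb (n~ vb) n~b ub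

    -- A triangle b a x of the complement would absorb c, making c non-adjacent to a.
    no-co-triangle-at-ab : ∀ {x} → x ≁ b → ¬ a ≁ x
    no-co-triangle-at-ab xb ax = proj₂ (co-triangle-absorbs n~b (n~ ab) (n~ xb) (n~ (≁-sym bc))
      (≁-sym ab) (≁-sym xb) ax (≁-sym bc) (~⇒≢ (~-sym ac))) (~-sym ac)

    -- A triangle b u v of the complement absorbs a, which yields a triangle through a and b.
    no-co-triangle-at-b : ∀ {u v} → u ≁ b → v ≁ b → ¬ u ≁ v
    no-co-triangle-at-b {u} {v} ub vb uv with a ≟ᵛ u
    ... | yes refl = no-co-triangle-at-ab vb uv
    ... | no a≢u   = no-co-triangle-at-ab ub (co-triangle-absorbs n~b (n~ ub) (n~ vb) (n~ ab)
      (≁-sym ub) (≁-sym vb) uv ab a≢u)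

    fits₂₂ : ∀ {u v} → u ≢ v → Class 2F u → Class 2F v → u ~ v
    fits₂₂ u≢v ub vb = ¬≁⇒~ u≢v (no-co-triangle-at-b ub vb)

    n~₁ : ∀ {u} → Class 1F u → n ~ u
    n~₁ cu@(ua , _) = fits₀₁ (λ { refl → proj₂ ua (n~ ab) }) (n~ ab , n~b) cu

    fits₁₁ : ∀ {u v} → u ≢ v → Class 1F u → Class 1F v → u ~ v
    fits₁₁ {u} {v} u≢v cu@(ua , ¬ub) cv@(va , ¬vb) = ¬≁⇒~ u≢v contra
      where
      contra : ¬ u ≁ v
      contra uv with b ≟ᵛ u
      ... | yes refl = ¬vb (≁-sym uv)
      -- The triangle a u v of the complement absorbs b, although u is not in class `2F`.
      ... | no b≢u   = ¬ub (≁-sym (co-triangle-absorbs (n~ ab) (n~₁ cu) (n~₁ cv) n~b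
        (≁-sym ua) (≁-sym va) uv (≁-sym ab) b≢u))

    fits₁₂ : ∀ {u v} → u ≢ v → Class 1F u → Class 2F v → u ≁ v
    fits₁₂ {u} {v} u≢v (ua , ¬ub) vb with v ≟ᵛ a | u ≟ᵛ b
    ... | yes refl | _        = ua
    ... | no _     | yes refl = ≁-sym vb
    -- Were u and v adjacent, u a b v would be an induced path of the complement.
    ... | no v≢a   | no u≢b   = u≢v , λ uv →
      no-co-P₄ ua ab (≁-sym vb) (¬≁⇒~ u≢b ¬ub) uv (fits₂₂ (≢-sym v≢a) ab vb)

    colouring : Colouring edgeless∨cliques G
    colouring = colouring-by edgeless∨cliques Class class fits
      where
      fits : ∀ i j {u v} → u ≢ v → Class i u → Class j v → Agrees (edgeless∨cliques i j) u v
      fits 0F 0F = fits₀₀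
      fits 0F 1F = fits₀₁
      fits 0F 2F = fits₀₂
      fits 1F 0F u≢v cu cv = ~-sym (fits₀₁ (≢-sym u≢v) cv cu)
      fits 1F 1F = fits₁₁
      fits 1F 2F = fits₁₂
      fits 2F 0F u≢v cu cv = ~-sym (fits₀₂ (≢-sym u≢v) cv cu)
      fits 2F 1F u≢v cu cv = ≁-sym (fits₁₂ (≢-sym u≢v) cv cu)
      fits 2F 2F = fits₂₂

  colouring : Connected G → Colouring tripartite G ⊎ Colouring edgeless∨cliques G
  colouring conn
    with search V↔Fin (λ a → search V↔Fin λ b → search V↔Fin λ c →
           a ≁? b ×-dec b ≁? c ×-dec a ~? c)
  ... | yes (a , b , c , ab , bc , ac) = inj₂ (Co-P₃.colouring conn ab bc ac)
  ... | no ¬co-P₃ = Non-adjacency-transitive.colouring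
    λ ab bc ac → ¬co-P₃ (_ , _ , _ , ab , bc , ac)

theorem4p3 : (G : Graph) → Finite G → Connected G →
    (𝓕₂ -Free) G ⇔
    (∃[ m ] ∃[ n ] ∃[ o ]
    (G InducedSubgraphOf K⟨ m , n , o ⟩ ⊎ G InducedSubgraphOf (Edgeless n ∨ (K m ⊍ K o))))
theorem4p3 G (N , V↔Fin) conn = mk⇔
  (λ free → N , N , N ,
    Sum.map (Colouring⇒⊆K⟨⟩ V↔Fin) (Colouring⇒⊆∨⊍ V↔Fin) (Free.colouring V↔Fin free conn))
  λ { (m , n , o , inj₁ G⊆K) → Uncolourable⇒Free 𝓕₂-not-tripartite
        (Colouring-pullback (⊆⇒Embedding {G = K⟨ m , n , o ⟩} G⊆K) K⟨⟩-Colouring)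
    ; (m , n , o , inj₂ G⊆J) → Uncolourable⇒Free 𝓕₂-not-edgeless∨cliques
        (Colouring-pullback (⊆⇒Embedding {G = Edgeless n ∨ (K m ⊍ K o)} G⊆J) ∨⊍-Colouring) }
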